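{- Let $q=5$ and let $S,T,H_1,H_2,G_1$ be the sets and graphs specified in the context. Then the amalgam graph $B^*_5(S,TT)$ is a $(\{6,7\};5)$-cage of order $43$.
   Context: All graphs are finite, undirected and simple. The girth of a graph is the length of a shortest cycle. For integers $2\le r<m$, an $(\{r,m\};g)$-graph is a graph of girth exactly $g$ whose set of vertex degrees is exactly $\{r,m\}$, and an $(\{r,m\};g)$-cage is an $(\{r,m\};g)$-graph of minimum possible order. Let $GF(5)=\mathbb Z_5$ and $GF^*(5)=GF(5)\setminus\{0\}$. The graph $B_5$ is the bipartite graph with vertex classes $V_0=\{(x,y)_0: x,y\in GF(5)\}$ and $V_1=\{(m,b)_1: m,b\in GF(5)\}$, in which $(x,y)_0$ is adjacent to $(m,b)_1$ if and only if $y=mx+b$. Let $T=\{3\}$ and $S=\{0,3\}$. The graph $B_5(S,TT)$ is obtained from $B_5$ by deleting the vertices $(0,y)_0$ with $y\in S$ and the vertices $(j,b)_1$ with $b\in T$, for every $j\in GF(5)$. $H_1$ is the graph with vertex set $GF(5)\setminus S=\{1,2,4\}$ and edges $\{2,4\},\{4,1\}$. $G_1$ is the graph with vertex set $GF(5)$ and edges $\{0,2\},\{2,4\},\{4,1\},\{1,3\},\{3,0\}$. $H_2$ is the graph with vertex set $GF(5)\setminus T=\{0,1,2,4\}$ and edges $\{4,0\},\{0,1\},\{1,2\}$. The amalgam $B^*_5(S,TT)$ is obtained from $B_5(S,TT)$ by adding the edges: $(0,u)_0(0,v)_0$ for $uv\in E(H_1)$; $(x,u)_0(x,v)_0$ for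 every $x\in GF^*(5)$ and $uv\in E(G_1)$; $(j,u)_1(j,v)_1$ for every $j\in GF(5)$ and $uv\in E(H_2)$. -}

module Defs where

open import Data.Bool.Base as Bool using (Bool; true; false)
open import Data.Bool.Properties using (T-irrelevant)
open import Data.Empty using (⊥)
open import Data.Fin.Base using (Fin; zero; suc; toℕ)
open import Data.Fin.Patterns using (0F; 1F; 2F; 3F; 4F)
open import Data.Fin.Properties using (_≟_; +↔⊎; *↔×)
open import Data.Fin.Subset using (Subset; _∈_; ⁅_⁆; _∪_; ∁) renaming (⊤ to full)
open import Data.Fin.Subset.Properties using (_∈?_)
open import Data.List.Base using (List; []; _∷_; map; filter; length; allFin)
import Data.List.Membership.Propositional as List
import Data.List.Membership.DecPropositional as DecList
open import Data.List.Relation.Unary.All using (All; all?) renaming (lookup to All-lookup)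
open import Data.Nat.Base using (ℕ; zero; suc; _+_; _*_; _≤_; _<_)
open import Data.Nat.DivMod using (_mod_)
open import Data.Product.Base using (Σ; ∃; _×_; _,_; proj₁; proj₂)
open import Data.Product.Properties using (≡-dec)
open import Data.Sum.Base using (_⊎_; inj₁; inj₂)
import Data.Sum.Base as Sum
open import Data.Sum.Function.Propositional using (_⊎-↔_)
open import Data.Unit.Base using (tt)
open import Function.Base using (_∘_; _on_)
open import Function.Bundles using (_↔_; _⇔_; Inverse; mk↔ₛ′)
open import Function.Construct.Composition using (_↔-∘_)
open import Function.Construct.Symmetry using (↔-sym)
open import Function.Definitions using (Injective)
open import Level using (0ℓ)
open import Relation.Binary.Core using (Rel)
open import Relation.Binary.Definitions using (Decidable; DecidableEquality; Symmetric; Irreflexive)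
open import Relation.Binary.PropositionalEquality
  using (_≡_; _≢_; refl; sym; cong; subst)
open import Relation.Nullary.Decidable
  using (yes; no; True; False; isYes; isNo; T?; map′; ¬?; _×-dec_; _⊎-dec_; toWitness)
import Relation.Unary as Unary

record Graph : Set₁ where
  field
    Vertex      : Set
    order       : ℕ
    enumeration : Vertex ↔ Fin order
    Adj         : Rel Vertex 0ℓ
    Adj?        : Decidable Adj
    Adj-sym     : Symmetric Adj
    Adj-irrefl  : Irreflexive _≡_ Adj

  vertices : List Vertex
  vertices = map (Inverse.from enumeration) (allFin order)

  neighbours : Vertex → List Vertex
  neighbours v = filter (Adj? v) vertices

  degree : Vertex → ℕ
  degree v = length (neighbours v)

open Graph

-- A cycle of length k: distinct vertices 0, …, k-1, consecutive ones adjacent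
-- (step), and the last adjacent to the first (close).
record Cycle (G : Graph) (k : ℕ) : Set where
  field
    3≤length  : 3 ≤ k
    vertex    : Fin k → Vertex G
    injective : Injective _≡_ _≡_ vertex
    step      : ∀ {i j} → toℕ j ≡ 1 + toℕ i → Adj G (vertex i) (vertex j)
    close     : ∀ {i j} → 1 + toℕ i ≡ k → toℕ j ≡ 0 → Adj G (vertex i) (vertex j)

HasGirth : Graph → ℕ → Set
HasGirth G g = Cycle G g × (∀ {k} → Cycle G k → g ≤ k)

HasDegreeSet : Graph → ℕ → ℕ → Set
HasDegreeSet G r m = ∀ d → (∃ λ v → degree G v ≡ d) ⇔ (d ≡ r ⊎ d ≡ m)

-- G is an ({r,m};g)-graph.
record IsDegreeGirthGraph (r m g : ℕ) (G : Graph) : Set where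
  field
    2≤r       : 2 ≤ r
    r<m       : r < m
    degreeSet : HasDegreeSet G r m
    girth     : HasGirth G g

-- G is an ({r,m};g)-cage.
record IsCage (r m g : ℕ) (G : Graph) : Set₁ where
  field
    isDegreeGirthGraph : IsDegreeGirthGraph r m g G
    minimal            : ∀ H → IsDegreeGirthGraph r m g H → order G ≤ order H

bit : Bool → ℕ
bit true  = 1
bit false = 0

count : ∀ {n} → (Fin n → Bool) → ℕ
count {zero}        f = 0
count {suc n} f = bit (f zero) + count (f ∘ suc)

T↔Fin : ∀ b → Bool.T b ↔ Fin (bit b)
T↔Fin true  = mk↔ₛ′ (λ _ → zero) (λ _ → tt) (λ { zero → refl }) (λ _ → refl)
T↔Fin false = mk↔ₛ′ (λ ()) (λ ()) (λ ()) (λ ())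

count-↔ : ∀ {n} (f : Fin n → Bool) → Σ (Fin n) (Bool.T ∘ f) ↔ Fin (count f)
count-↔ {zero}        f = mk↔ₛ′ (λ { (() , _) }) (λ ()) (λ ()) (λ { (() , _) })
count-↔ {suc n} f = ↔-sym +↔⊎ ↔-∘ ((T↔Fin (f zero) ⊎-↔ count-↔ (f ∘ suc)) ↔-∘ split)
  where
  split : Σ (Fin (suc n)) (Bool.T ∘ f) ↔ (Bool.T (f zero) ⊎ Σ (Fin n) (Bool.T ∘ f ∘ suc))
  split = mk↔ₛ′
    (λ { (zero , p) → inj₁ p ; (suc i , p) → inj₂ (i , p) })
    (λ { (inj₁ p) → zero , p ; (inj₂ (i , p)) → suc i , p })
    (λ { (inj₁ _) → refl ; (inj₂ _) → refl })
    (λ { (zero , _) → refl ; (suc _ , _) → refl })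

T-Σ-≡ : {A : Set} {f : A → Bool} {u v : Σ A (Bool.T ∘ f)} → proj₁ u ≡ proj₁ v → u ≡ v
T-Σ-≡ {u = a , p} {v = .a , q} refl = cong (a ,_) (T-irrelevant p q)

restrict-↔ : {A : Set} {n : ℕ} (e : A ↔ Fin n) (f : A → Bool) →
             Σ A (Bool.T ∘ f) ↔ Fin (count (f ∘ Inverse.from e))
restrict-↔ e f = count-↔ (f ∘ from) ↔-∘ mk↔ₛ′
  (λ { (a , p) → to a , subst (Bool.T ∘ f) (sym (strictlyInverseʳ a)) p })
  (λ { (i , p) → from i , p })
  (λ { (i , p) → T-Σ-≡ (strictlyInverseˡ i) })
  (λ { (a , p) → T-Σ-≡ (strictlyInverseʳ a) })
  where open Inverse e

deleteVertices : (G : Graph) {P : Vertex G → Set} → Unary.Decidable P → Graph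
deleteVertices G P? = record
  { Vertex      = Σ (Vertex G) (λ v → False (P? v))
  ; order       = count (isNo ∘ P? ∘ Inverse.from (enumeration G))
  ; enumeration = restrict-↔ (enumeration G) (isNo ∘ P?)
  ; Adj         = Adj G on proj₁
  ; Adj?        = λ u v → Adj? G (proj₁ u) (proj₁ v)
  ; Adj-sym     = Adj-sym G
  ; Adj-irrefl  = λ { refl → Adj-irrefl G refl }
  }

addEdges : (G : Graph) (E : Rel (Vertex G) 0ℓ) →
           Decidable E → Symmetric E → Irreflexive _≡_ E → Graph
addEdges G E E? E-sym E-irrefl = record
  { Vertex      = Vertex G
  ; order       = order G
  ; enumeration = enumeration G
  ; Adj         = λ u v → Adj G u v ⊎ E u v
  ; Adj?        = λ u v → Adj? G u v ⊎-dec E? u v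
  ; Adj-sym     = Sum.map (Adj-sym G) E-sym
  ; Adj-irrefl  = λ { u≡v (inj₁ a) → Adj-irrefl G u≡v a ; u≡v (inj₂ e) → E-irrefl u≡v e }
  }

-- Membership as `True` of a decision, so that its proofs are unique and are
-- found by computation.
Elem : ∀ {n} → Subset n → Set
Elem {n} W = Σ (Fin n) (λ u → True (u ∈? W))

elem : ∀ {n} {W : Subset n} (u : Fin n) {u∈W : True (u ∈? W)} → Elem W
elem u {u∈W} = u , u∈W

_≟ᴱ_ : ∀ {n} {W : Subset n} → DecidableEquality (Elem W)
u ≟ᴱ v = map′ T-Σ-≡ (cong proj₁) (proj₁ u ≟ proj₁ v)

Loopless : ∀ {n} {W : Subset n} → List (Elem W × Elem W) → Set
Loopless = All (λ e → proj₁ e ≢ proj₂ e)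

loopless? : ∀ {n} {W : Subset n} → Unary.Decidable (Loopless {n} {W})
loopless? = all? (λ e → ¬? (proj₁ e ≟ᴱ proj₂ e))

-- The graph with vertex set W whose edges are the unordered pairs listed in es.
fromEdges : ∀ {n} (W : Subset n) (es : List (Elem W × Elem W)) {_ : True (loopless? es)} → Graph
fromEdges {n} W es {loopless} = record
  { Vertex      = Elem W
  ; order       = count (λ u → isYes (u ∈? W))
  ; enumeration = count-↔ (λ u → isYes (u ∈? W))
  ; Adj         = λ u v → (u , v) List.∈ es ⊎ (v , u) List.∈ es
  ; Adj?        = λ u v → ((u , v) ∈ᴸ? es) ⊎-dec ((v , u) ∈ᴸ? es)
  ; Adj-sym     = Sum.swap
  ; Adj-irrefl  = λ { refl (inj₁ e) → All-lookup (toWitness loopless) e refl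
                    ; refl (inj₂ e) → All-lookup (toWitness loopless) e refl }
  }
  where open DecList (≡-dec (_≟ᴱ_ {W = W}) _≟ᴱ_) renaming (_∈?_ to _∈ᴸ?_)

GF5 : Set
GF5 = Fin 5

infixl 6 _+₅_
infixl 7 _*₅_

_+₅_ _*₅_ : GF5 → GF5 → GF5
a +₅ b = (toℕ a + toℕ b) mod 5
a *₅ b = (toℕ a * toℕ b) mod 5

Vertex₅ : Set
Vertex₅ = (GF5 × GF5) ⊎ (GF5 × GF5)

pattern ⟨_,_⟩₀ x y = inj₁ (x , y)
pattern ⟨_,_⟩₁ m b = inj₂ (m , b)

Incident : Rel Vertex₅ 0ℓ
Incident ⟨ x , y ⟩₀ ⟨ m , b ⟩₁ = y ≡ m *₅ x +₅ b
Incident ⟨ m , b ⟩₁ ⟨ x , y ⟩₀ = y ≡ m *₅ x +₅ b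
Incident ⟨ _ , _ ⟩₀ ⟨ _ , _ ⟩₀ = ⊥
Incident ⟨ _ , _ ⟩₁ ⟨ _ , _ ⟩₁ = ⊥

incident? : Decidable Incident
incident? ⟨ x , y ⟩₀ ⟨ m , b ⟩₁ = y ≟ m *₅ x +₅ b
incident? ⟨ m , b ⟩₁ ⟨ x , y ⟩₀ = y ≟ m *₅ x +₅ b
incident? ⟨ _ , _ ⟩₀ ⟨ _ , _ ⟩₀ = no λ ()
incident? ⟨ _ , _ ⟩₁ ⟨ _ , _ ⟩₁ = no λ ()

incident-sym : Symmetric Incident
incident-sym {⟨ _ , _ ⟩₀} {⟨ _ , _ ⟩₁} e = e
incident-sym {⟨ _ , _ ⟩₁} {⟨ _ , _ ⟩₀} e = e

incident-irrefl : Irreflexive _≡_ Incident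
incident-irrefl {⟨ _ , _ ⟩₀} refl ()
incident-irrefl {⟨ _ , _ ⟩₁} refl ()

B₅ : Graph
B₅ = record
  { Vertex      = Vertex₅
  ; order       = 50
  ; enumeration = ↔-sym +↔⊎ ↔-∘ (↔-sym *↔× ⊎-↔ ↔-sym *↔×)
  ; Adj         = Incident
  ; Adj?        = incident?
  ; Adj-sym     = λ {u} {v} → incident-sym {u} {v}
  ; Adj-irrefl  = incident-irrefl
  }

S T : Subset 5
S = ⁅ 0F ⁆ ∪ ⁅ 3F ⁆
T = ⁅ 3F ⁆

Deleted : Vertex₅ → Set
Deleted ⟨ x , y ⟩₀ = x ≡ 0F × y ∈ S
Deleted ⟨ j , b ⟩₁ = b ∈ T

deleted? : Unary.Decidable Deleted
deleted? ⟨ x , y ⟩₀ = (x ≟ 0F) ×-dec (y ∈? S)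
deleted? ⟨ j , b ⟩₁ = b ∈? T

B₅[S,TT] : Graph
B₅[S,TT] = deleteVertices B₅ deleted?

H₁ : Graph
H₁ = fromEdges (∁ S) ((elem 2F , elem 4F) ∷ (elem 4F , elem 1F) ∷ [])

G₁ : Graph
G₁ = fromEdges (full {5})
  ( (elem 0F , elem 2F) ∷ (elem 2F , elem 4F) ∷ (elem 4F , elem 1F)
  ∷ (elem 1F , elem 3F) ∷ (elem 3F , elem 0F) ∷ [] )

H₂ : Graph
H₂ = fromEdges (∁ T) ((elem 4F , elem 0F) ∷ (elem 0F , elem 1F) ∷ (elem 1F , elem 2F) ∷ [])

-- "uv ∈ E(H)" for a graph H on W and arbitrary u, v in the ambient set.
AdjIn : ∀ {n} (W : Subset n) → Rel (Elem W) 0ℓ → Rel (Fin n) 0ℓ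
AdjIn W R u v = Σ (True (u ∈? W)) λ p → Σ (True (v ∈? W)) λ q → R (u , p) (v , q)

adjIn? : ∀ {n} (W : Subset n) {R : Rel (Elem W) 0ℓ} → Decidable R → Decidable (AdjIn W R)
adjIn? W {R} R? u v with T? (isYes (u ∈? W)) | T? (isYes (v ∈? W))
... | no ¬p | _     = no λ { (p , _) → ¬p p }
... | yes _ | no ¬q = no λ { (_ , q , _) → ¬q q }
... | yes p | yes q = map′ (λ r → p , q , r)
  (λ { (p′ , q′ , r) → subst (λ z → R (u , z) (v , q)) (T-irrelevant p′ p)
                        (subst (λ z → R (u , p′) (v , z)) (T-irrelevant q′ q) r) })
  (R? (u , p) (v , q))

-- The new edges, as a relation on the vertices of B₅; every H₁- and H₂-edge
-- automatically joins vertices that survive in B₅[S,TT].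
data NewEdge : Rel Vertex₅ 0ℓ where
  H₁-edge : ∀ {u v} → AdjIn (∁ S) (Adj H₁) u v → NewEdge ⟨ 0F , u ⟩₀ ⟨ 0F , v ⟩₀
  G₁-edge : ∀ {x u v} → x ≢ 0F → AdjIn full (Adj G₁) u v → NewEdge ⟨ x , u ⟩₀ ⟨ x , v ⟩₀
  H₂-edge : ∀ {j u v} → AdjIn (∁ T) (Adj H₂) u v → NewEdge ⟨ j , u ⟩₁ ⟨ j , v ⟩₁

newEdge? : Decidable NewEdge
newEdge? ⟨ x , u ⟩₀ ⟨ y , v ⟩₀ = map′
  (λ { (refl , inj₁ (refl , e)) → H₁-edge e
     ; (refl , inj₂ (x≢0 , e))  → G₁-edge x≢0 e })
  (λ { (H₁-edge e)     → refl , inj₁ (refl , e)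
     ; (G₁-edge x≢0 e) → refl , inj₂ (x≢0 , e) })
  ((x ≟ y) ×-dec (((x ≟ 0F) ×-dec adjIn? (∁ S) (Adj? H₁) u v)
                  ⊎-dec (¬? (x ≟ 0F) ×-dec adjIn? full (Adj? G₁) u v)))
newEdge? ⟨ i , u ⟩₁ ⟨ j , v ⟩₁ = map′
  (λ { (refl , e) → H₂-edge e })
  (λ { (H₂-edge e) → refl , e })
  ((i ≟ j) ×-dec adjIn? (∁ T) (Adj? H₂) u v)
newEdge? ⟨ _ , _ ⟩₀ ⟨ _ , _ ⟩₁ = no λ ()
newEdge? ⟨ _ , _ ⟩₁ ⟨ _ , _ ⟩₀ = no λ ()

newEdge-sym : Symmetric NewEdge
newEdge-sym (H₁-edge (p , q , e))     = H₁-edge (q , p , Adj-sym H₁ {_ , p} {_ , q} e)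
newEdge-sym (G₁-edge x≢0 (p , q , e)) = G₁-edge x≢0 (q , p , Adj-sym G₁ {_ , p} {_ , q} e)
newEdge-sym (H₂-edge (p , q , e))     = H₂-edge (q , p , Adj-sym H₂ {_ , p} {_ , q} e)

newEdge-irrefl : Irreflexive _≡_ NewEdge
newEdge-irrefl refl (H₁-edge (p , q , e))   = Adj-irrefl H₁ {_ , p} {_ , q} (T-Σ-≡ refl) e
newEdge-irrefl refl (G₁-edge _ (p , q , e)) = Adj-irrefl G₁ {_ , p} {_ , q} (T-Σ-≡ refl) e
newEdge-irrefl refl (H₂-edge (p , q , e))   = Adj-irrefl H₂ {_ , p} {_ , q} (T-Σ-≡ refl) e

B*₅[S,TT] : Graph
B*₅[S,TT] = addEdges B₅[S,TT] (NewEdge on proj₁)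
  (λ u v → newEdge? (proj₁ u) (proj₁ v))
  newEdge-sym
  (λ { refl → newEdge-irrefl refl })

-- In a graph without triangles and 4-cycles, distinct neighbours u of a vertex v have no
-- common neighbour but v, so v, its neighbours and their remaining neighbours are all
-- distinct.  For a vertex of degree 7 and minimum degree 6 this gives 1 + 7 + 7 * 5 = 43
-- vertices, which is the order of B*₅[S,TT].  That B*₅[S,TT] has degree set {6,7} and no
-- triangles or 4-cycles is decided by evaluation, and a pentagon of G₁ is a 5-cycle.

{-# OPTIONS --safe #-}
module Submission where

open import Defs
open import Data.Bool.Base using (Bool)
open import Data.Fin.Base using (Fin; zero; suc; toℕ)
open import Data.Fin.Patterns using (0F; 1F; 2F; 3F; 4F)
import Data.Fin.Properties as Fin
open import Data.List.Base using (List; []; _∷_; _++_; _∷ʳ_; concatMap; filter; length; lookup)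
open import Data.List.Membership.Propositional using (_∈_; find)
open import Data.List.Membership.Propositional.Properties
  using (∈-filter⁻; ∈-concatMap⁻; ∈-lookup)
open import Data.List.Properties using (filter-all; length-++)
open import Data.List.Relation.Unary.All as All using (All; []; _∷_)
open import Data.List.Relation.Unary.All.Properties using (all-filter; ++⁺)
open import Data.List.Relation.Unary.AllPairs using ([]; _∷_)
open import Data.List.Relation.Unary.Linked using (Linked; [-]; _∷_; linked?)
open import Data.List.Relation.Unary.Unique.Propositional using (Unique)
import Data.List.Relation.Unary.Unique.Propositional.Properties as Unique
import Data.List.Relation.Unary.Unique.DecPropositional as DecUnique
open import Data.Nat.Base using (ℕ; zero; suc; _+_; _*_; _≤_; z≤n; s≤s)
import Data.Nat.Properties as ℕ
open import Data.Product.Base using (_×_; _,_; proj₁; proj₂)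
open import Data.Sum.Base using (_⊎_; inj₁; inj₂; [_,_]′)
open import Data.Unit.Base using (tt)
open import Data.Vec.Base as Vec using (Vec; tabulate)
open import Data.Vec.Properties using (lookup-map; lookup∘tabulate)
open import Function.Base using (_∘_; _on_)
open import Function.Bundles using (Inverse; Injection; Equivalence; mk⇔)
open import Function.Construct.Symmetry using (↔-sym)
open import Function.Definitions using (Injective)
open import Function.Properties.Inverse using (↔⇒↣)
open import Level using (0ℓ)
open import Relation.Binary.Core using (Rel)
open import Relation.Binary.Definitions using (Decidable; DecidableEquality)
open import Relation.Binary.PropositionalEquality
  using (_≡_; _≢_; refl; sym; cong; subst; subst₂)
open import Relation.Nullary.Decidable
  using (Dec; yes; no; does; proof; _because_; map′; ¬?; _⊎-dec_; _→-dec_; from-yes; via-injection)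
open import Relation.Nullary.Negation using (¬_; contradiction)
open import Relation.Nullary.Reflects using (Reflects)
import Relation.Unary as Unary

open Graph

-- Duplicate-free lists and closed walks.

lookup-injective : {A : Set} {xs : List A} → Unique xs → Injective _≡_ _≡_ (lookup xs)
lookup-injective (_ ∷ _)   {zero}  {zero}  _ = refl
lookup-injective (x∉ ∷ _)  {zero}  {suc j} e = contradiction e (All.lookup x∉ (∈-lookup j))
lookup-injective (x∉ ∷ _)  {suc i} {zero}  e = contradiction (sym e) (All.lookup x∉ (∈-lookup i))
lookup-injective (_ ∷ xs!) {suc i} {suc j} e = cong suc (lookup-injective xs! e)

length≤1+length-filter-≢ : {A : Set} (_≟_ : DecidableEquality A) (v : A) {xs : List A} → Unique xs →
                           length xs ≤ 1 + length (filter (λ w → ¬? (v ≟ w)) xs)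
length≤1+length-filter-≢ _≟_ v [] = z≤n
length≤1+length-filter-≢ _≟_ v (_∷_ {x} x∉ xs!) with v ≟ x
... | no _     = s≤s (length≤1+length-filter-≢ _≟_ v xs!)
-- Once the head is `v`, freshness `x∉` makes the filter keep the whole tail, so only one entry is
-- ever lost.
... | yes refl = ℕ.≤-reflexive (cong (suc ∘ length) (sym (filter-all (λ w → ¬? (v ≟ w)) x∉)))

length-concatMap≥ : {A B : Set} {s : ℕ} (f : A → List B) → (∀ x → s ≤ length (f x)) →
                    ∀ xs → length xs * s ≤ length (concatMap f xs)
length-concatMap≥ f s≤ []       = z≤n
length-concatMap≥ f s≤ (x ∷ xs) =
  ℕ.≤-trans (ℕ.+-mono-≤ (s≤ x) (length-concatMap≥ f s≤ xs)) (ℕ.≤-reflexive (sym (length-++ (f x))))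

module _ {A : Set} {R : Rel A 0ℓ} {y : A} where

  linked-step : ∀ {xs} → Linked R (xs ∷ʳ y) → ∀ {i j} → toℕ j ≡ 1 + toℕ i →
                R (lookup xs i) (lookup xs j)
  linked-step {_ ∷ _ ∷ _} (r ∷ _)  {zero}  {suc zero} refl = r
  linked-step {_ ∷ _ ∷ _} (_ ∷ rs) {suc i} {suc j}    e    = linked-step rs (ℕ.suc-injective e)

  linked-last : ∀ {xs} → Linked R (xs ∷ʳ y) → ∀ {i} → 1 + toℕ i ≡ length xs → R (lookup xs i) y
  linked-last {_ ∷ []}    (r ∷ _)  {zero}  _ = r
  linked-last {_ ∷ _ ∷ _} (_ ∷ rs) {suc i} e = linked-last rs (ℕ.suc-injective e)

-- Repeating `x` at the end turns the closing edge into the last link of a chain, so a single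
-- `Linked` proof supplies both `step` and `close`.
closedWalk⇒cycle : ∀ {G x xs} → 3 ≤ length (x ∷ xs) → Unique (x ∷ xs) →
                   Linked (Adj G) (x ∷ xs ∷ʳ x) → Cycle G (length (x ∷ xs))
closedWalk⇒cycle {G} {x} {xs} 3≤ xs! walk = record
  { 3≤length  = 3≤
  ; vertex    = lookup (x ∷ xs)
  ; injective = lookup-injective xs!
  ; step      = linked-step {xs = x ∷ xs} walk
  ; close     = λ { {j = zero} e _ → linked-last {xs = x ∷ xs} walk e }
  }

-- The order of the hypotheses lets the deciding search below prune early.
TriangleFree SquareFree : {A : Set} → Rel A 0ℓ → Set
TriangleFree R = ∀ a b → R a b → ∀ c → R b c → ¬ R c a
SquareFree   R = ∀ a b → R a b → ∀ c → R b c → a ≢ c → ∀ d → R c d → R d a → b ≡ d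

-- Girth at least five as absence of triangles and squares.

module _ (G : Graph) where

  open Inverse (enumeration G) using (to; from; strictlyInverseʳ)
  open Injection (↔⇒↣ (enumeration G)) using () renaming (injective to to-injective)

  infix 4 _≟ᵛ_

  _≟ᵛ_ : DecidableEquality (Vertex G)
  _≟ᵛ_ = via-injection (↔⇒↣ (enumeration G)) Fin._≟_

  allVertices? : {P : Vertex G → Set} → Unary.Decidable P → Dec (∀ v → P v)
  allVertices? {P} P? = map′ (λ p v → subst P (strictlyInverseʳ v) (p (to v))) (_∘ from)
    (Fin.all? (P? ∘ from))

  adj-indices : ∀ {u v} → Adj G u v → (Adj G on from) (to u) (to v)
  adj-indices = subst₂ (Adj G) (sym (strictlyInverseʳ _)) (sym (strictlyInverseʳ _))

  triangleFree-indices : TriangleFree (Adj G on from) → TriangleFree (Adj G)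
  triangleFree-indices free a b ab c bc ca =
    free _ _ (adj-indices ab) _ (adj-indices bc) (adj-indices ca)

  -- The search runs over indices. Injectivity of `to` carries `a ≢ c` to the indices and brings the
  -- resulting equality back to vertices.
  squareFree-indices : SquareFree (Adj G on from) → SquareFree (Adj G)
  squareFree-indices free a b ab c bc a≢c d cd da = to-injective
    (free _ _ (adj-indices ab) _ (adj-indices bc) (a≢c ∘ to-injective) _ (adj-indices cd) (adj-indices da))

  -- Pigeonhole: positions in the list inject into the indices of the vertices.
  length-unique≤order : ∀ {xs} → Unique xs → length xs ≤ order G
  length-unique≤order xs! = Fin.injective⇒≤ (lookup-injective xs! ∘ to-injective)

  adj⇒≢ : ∀ {u v} → Adj G u v → u ≢ v
  adj⇒≢ uv u≡v = Adj-irrefl G u≡v uv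

  neighbours-unique : ∀ v → Unique (neighbours G v)
  neighbours-unique v = Unique.filter⁺ (Adj? G v)
    (Unique.map⁺ (Injection.injective (↔⇒↣ (↔-sym (enumeration G)))) (Unique.allFin⁺ (order G)))

  neighbours-adj : ∀ v → All (Adj G v) (neighbours G v)
  neighbours-adj v = all-filter (Adj? G v) (vertices G)

  -- In a 4-cycle, vertices 1 and 3 are common neighbours of the distinct vertices 0 and 2.
  -- `SquareFree` would identify them, against injectivity.
  girth≥5 : TriangleFree (Adj G) → SquareFree (Adj G) → ∀ {k} → Cycle G k → 5 ≤ k
  girth≥5 _ _ {0} record { 3≤length = () }
  girth≥5 _ _ {1} record { 3≤length = s≤s () }
  girth≥5 _ _ {2} record { 3≤length = s≤s (s≤s ()) }
  girth≥5 triangleFree _ {3} C = contradiction (close {2F} {0F} refl refl)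
    (triangleFree _ _ (step {0F} {1F} refl) _ (step {1F} {2F} refl))
    where open Cycle C
  girth≥5 _ squareFree {4} C = contradiction
    (injective {1F} {3F} (squareFree _ _ (step {0F} {1F} refl) _ (step {1F} {2F} refl)
      (λ e → contradiction (injective {0F} {2F} e) λ ())
      _ (step {2F} {3F} refl) (close {3F} {0F} refl refl)))
    λ ()
    where open Cycle C
  girth≥5 _ _ {suc (suc (suc (suc (suc _))))} _ = s≤s (s≤s (s≤s (s≤s (s≤s z≤n))))

  module _ (5≤cycle : ∀ {k} → Cycle G k → 5 ≤ k) where

    girth≥5⇒triangleFree : TriangleFree (Adj G)
    girth≥5⇒triangleFree a b ab c bc ca = contradiction
      (5≤cycle (closedWalk⇒cycle (s≤s (s≤s (s≤s z≤n)))
        ((adj⇒≢ ab ∷ adj⇒≢ (Adj-sym G ca) ∷ []) ∷ (adj⇒≢ bc ∷ []) ∷ [] ∷ [])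
        (ab ∷ bc ∷ ca ∷ [-])))
      λ { (s≤s (s≤s (s≤s ()))) }

    -- If `b` and `d` differed, then both diagonals would join distinct vertices, the sides do so by
    -- irreflexivity, and the closed walk would be a 4-cycle.
    girth≥5⇒squareFree : SquareFree (Adj G)
    girth≥5⇒squareFree a b ab c bc a≢c d cd da with b ≟ᵛ d
    ... | yes b≡d = b≡d
    ... | no  b≢d = contradiction
      (5≤cycle (closedWalk⇒cycle (s≤s (s≤s (s≤s z≤n)))
        ((adj⇒≢ ab ∷ a≢c ∷ adj⇒≢ (Adj-sym G da) ∷ []) ∷ (adj⇒≢ bc ∷ b≢d ∷ []) ∷ (adj⇒≢ cd ∷ []) ∷ [] ∷ [])
        (ab ∷ bc ∷ cd ∷ da ∷ [-])))
      λ { (s≤s (s≤s (s≤s (s≤s ())))) }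

  -- Counting the ball of radius two around a vertex.

  module _ (triangleFree : TriangleFree (Adj G)) (squareFree : SquareFree (Adj G)) (v : Vertex G) where

    -- For a neighbour `u` of `v`, these are the children of `u` in the breadth-first tree rooted at
    -- `v`.
    branch : Vertex G → List (Vertex G)
    branch u = filter (λ w → ¬? (v ≟ᵛ w)) (neighbours G u)

    ∈-branch⁻ : ∀ {u w} → w ∈ branch u → Adj G u w × v ≢ w
    ∈-branch⁻ {u} w∈ with w∈N , v≢w ← ∈-filter⁻ (λ w → ¬? (v ≟ᵛ w)) {xs = neighbours G u} w∈ =
      All.lookup (neighbours-adj u) w∈N , v≢w

    -- A child `w` of `u` that were also adjacent to `v` would close the triangle `v`, `u`, `w`.
    ∈-branches⁻ : ∀ {us w} → w ∈ concatMap branch us → v ≢ w × (All (Adj G v) us → ¬ Adj G v w)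
    ∈-branches⁻ {us} w∈ with u , u∈us , w∈u ← find (∈-concatMap⁻ branch {xs = us} w∈)
                        with uw , v≢w ← ∈-branch⁻ {u} w∈u =
      v≢w , λ vus vw → triangleFree _ _ (All.lookup vus u∈us) _ uw (Adj-sym G vw)

    -- A vertex `w` in the branches of both `u` and `u′` would give the square `v`, `u`, `w`, `u′`;
    -- hence `u ≡ u′`, which `u∉us` excludes.
    branches-unique : ∀ {us} → All (Adj G v) us → Unique us → Unique (concatMap branch us)
    branches-unique {[]}     []         []          = []
    branches-unique {u ∷ us} (vu ∷ vus) (u∉us ∷ us!) = Unique.++⁺
      (Unique.filter⁺ (λ w → ¬? (v ≟ᵛ w)) (neighbours-unique u))
      (branches-unique vus us!)
      disjoint
      where
      disjoint : ∀ {w} → ¬ (w ∈ branch u × w ∈ concatMap branch us)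
      disjoint (w∈u , w∈us) with u′ , u′∈us , w∈u′ ← find (∈-concatMap⁻ branch {xs = us} w∈us)
                            with uw , v≢w ← ∈-branch⁻ {u} w∈u =
        All.lookup u∉us u′∈us
          (squareFree _ _ vu _ uw v≢w _ (Adj-sym G (proj₁ (∈-branch⁻ {u′} w∈u′)))
            (Adj-sym G (All.lookup vus u′∈us)))

    ball : List (Vertex G)
    ball = v ∷ neighbours G v ++ concatMap branch (neighbours G v)

    ball-unique : Unique ball
    ball-unique = ++⁺ (All.map adj⇒≢ vN)
                      (All.tabulate (proj₁ ∘ ∈-branches⁻ {neighbours G v}))
                ∷ Unique.++⁺ (neighbours-unique v) (branches-unique vN (neighbours-unique v))
                    (λ (w∈N , w∈) → proj₂ (∈-branches⁻ {neighbours G v} w∈) vN (All.lookup vN w∈N))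
      where vN = neighbours-adj v

    moore-bound : ∀ {s} → (∀ u → 1 + s ≤ degree G u) → 1 + (degree G v + degree G v * s) ≤ order G
    moore-bound {s} 1+s≤degree = begin
      1 + (degree G v + degree G v * s)                              ≤⟨ s≤s (ℕ.+-monoʳ-≤ (degree G v) branches≥) ⟩
      1 + (degree G v + length (concatMap branch (neighbours G v)))  ≡⟨ cong suc (length-++ (neighbours G v)) ⟨
      length ball                                                    ≤⟨ length-unique≤order ball-unique ⟩
      order G                                                        ∎
      where
      open ℕ.≤-Reasoning
      -- Each neighbour has at least `1 + s` neighbours, and removing `v` costs at most one of them.
      branches≥ = length-concatMap≥ branch (λ u → ℕ.≤-pred (ℕ.≤-trans (1+s≤degree u)
        (length≤1+length-filter-≢ _≟ᵛ_ v (neighbours-unique u)))) (neighbours G v)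

-- Exhaustive search with a memoised relation.

module _ {n} {R : Rel (Fin n) 0ℓ} (R? : Decidable R) where

  triangleFree? : Dec (TriangleFree R)
  triangleFree? = Fin.all? λ a → Fin.all? λ b → R? a b →-dec Fin.all? λ c → R? b c →-dec ¬? (R? c a)

  squareFree? : Dec (SquareFree R)
  squareFree? = Fin.all? λ a → Fin.all? λ b → R? a b →-dec Fin.all? λ c → R? b c →-dec
    ¬? (a Fin.≟ c) →-dec Fin.all? λ d → R? c d →-dec R? d a →-dec b Fin.≟ d

module _ {A : Set} {R : Rel A 0ℓ} (R? : Decidable R) where

  table : ∀ {n} → Vec A n → Vec (Vec Bool n) n
  table xs = Vec.map (λ x → Vec.map (λ y → does (R? x y)) xs) xs

  lookup-table : ∀ {n} (f : Fin n → A) i j →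
                 Vec.lookup (Vec.lookup (table (tabulate f)) i) j ≡ does (R? (f i) (f j))
  lookup-table f i j
    rewrite lookup-map i (λ x → Vec.map (λ y → does (R? x y)) (tabulate f)) (tabulate f)
          | lookup-map j (λ y → does (R? (Vec.lookup (tabulate f) i) y)) (tabulate f)
          | lookup∘tabulate f i | lookup∘tabulate f j = refl

  -- The Boolean comes from `M` and only the proof from `R?`, so a search that inspects Booleans
  -- alone just reads the matrix.
  byTable : ∀ {n} {f : Fin n → A} (M : Vec (Vec Bool n) n) →
            (∀ i j → Vec.lookup (Vec.lookup M i) j ≡ does (R? (f i) (f j))) → Decidable (R on f)
  byTable M M≡R i j = Vec.lookup (Vec.lookup M i) j because
    subst (Reflects _) (sym (M≡R i j)) (proof (R? _ _))

  -- As arguments, the vertices xs of `table` and the matrix M of `byTable` are shared by the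
  -- evaluator: each f i and each R? (f i) (f j) is computed only once.
  memoised : ∀ {n} (f : Fin n → A) → Decidable (R on f)
  memoised f = byTable (table (tabulate f)) (lookup-table f)

-- The amalgam as a graph of degrees six and seven and girth five.

module B* where

  open Inverse (enumeration B*₅[S,TT]) using (from)

  adj? : Decidable (Adj B*₅[S,TT] on from)
  adj? = memoised (Adj? B*₅[S,TT]) from

  triangleFree : TriangleFree (Adj B*₅[S,TT])
  triangleFree = triangleFree-indices B*₅[S,TT] (from-yes (triangleFree? adj?))

  squareFree : SquareFree (Adj B*₅[S,TT])
  squareFree = squareFree-indices B*₅[S,TT] (from-yes (squareFree? adj?))

  degree-6⊎7 : ∀ v → degree B*₅[S,TT] v ≡ 6 ⊎ degree B*₅[S,TT] v ≡ 7
  degree-6⊎7 = from-yes (allVertices? B*₅[S,TT] λ v →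
    (degree B*₅[S,TT] v ℕ.≟ 6) ⊎-dec (degree B*₅[S,TT] v ℕ.≟ 7))

  pentagon : Cycle B*₅[S,TT] 5
  pentagon = closedWalk⇒cycle (s≤s (s≤s (s≤s z≤n)))
    (from-yes (DecUnique.unique? (_≟ᵛ_ B*₅[S,TT]) (v 0F ∷ rest)))
    (from-yes (linked? (Adj? B*₅[S,TT]) (v 0F ∷ rest ∷ʳ v 0F)))
    where
    v : GF5 → Vertex B*₅[S,TT]
    -- Every nonzero first coordinate carries a full copy of the 5-cycle `G₁`; here it is 1, and
    -- `rest` follows the edges of `G₁` from 0.
    v y = ⟨ 1F , y ⟩₀ , tt
    rest = v 2F ∷ v 4F ∷ v 1F ∷ v 3F ∷ []

  isDegreeGirthGraph : IsDegreeGirthGraph 6 7 5 B*₅[S,TT]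
  isDegreeGirthGraph = record
    { 2≤r       = s≤s (s≤s z≤n)
    ; r<m       = ℕ.≤-refl
    ; degreeSet = λ d → mk⇔
        (λ { (v , refl) → degree-6⊎7 v })
        -- `⟨ 0F , y ⟩₀` is incident with the five `⟨ m , y ⟩₁`, and `H₁` is the path 2, 4, 1: its
        -- end 1 gains one edge and its midpoint 4 gains two.
        [ (λ { refl → (⟨ 0F , 1F ⟩₀ , tt) , refl }) , (λ { refl → (⟨ 0F , 4F ⟩₀ , tt) , refl }) ]′
    ; girth     = pentagon , girth≥5 B*₅[S,TT] triangleFree squareFree
    }

-- Minimality of the order.

43≤order : ∀ H → IsDegreeGirthGraph 6 7 5 H → 43 ≤ order H
43≤order H H-graph =
  let v , degree≡7 = Equivalence.from (degreeSet 7) (inj₂ refl)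
  -- With minimum degree 6, `s` is 5, and a vertex of degree 7 makes the bound evaluate to 43.
  in subst (λ m → 1 + (m + m * 5) ≤ order H) degree≡7
       (moore-bound H (girth≥5⇒triangleFree H (proj₂ girth)) (girth≥5⇒squareFree H (proj₂ girth))
         v 6≤degree)
  where
  open IsDegreeGirthGraph H-graph
  6≤degree : ∀ u → 6 ≤ degree H u
  6≤degree u with Equivalence.to (degreeSet (degree H u)) (u , refl)
  ... | inj₁ degree≡6 = ℕ.≤-reflexive (sym degree≡6)
  ... | inj₂ degree≡7 = ℕ.≤-trans (ℕ.n≤1+n 6) (ℕ.≤-reflexive (sym degree≡7))

theorem6p2 : IsCage 6 7 5 B*₅[S,TT] × Graph.order B*₅[S,TT] ≡ 43
-- The order evaluates to 50 - 2 - 5: two vertices `⟨ 0F , y ⟩₀` and the five `⟨ j , 3F ⟩₁` are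
-- deleted.
theorem6p2 = record { isDegreeGirthGraph = B*.isDegreeGirthGraph ; minimal = 43≤order } , refl
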